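{- For every positive integer $N$, $$\sum_{\mu\in\mathcal{RL}_N} q^{|\mu|}=\sum_{\lambda\in\mathcal{ROP}_N} q^{|\lambda|},$$ where $\mathcal{RL}_N$ is the set of reduced lecture hall partitions of width $N$ and $\mathcal{ROP}_N$ is the set of $N$-party reduced odd partitions.
   Context: A partition is a finite weakly decreasing sequence $\lambda=(\lambda_1\ge\lambda_2\ge\dots\ge\lambda_\ell>0)$ of positive integers (the empty partition $\emptyset$ is allowed); $\ell(\lambda)=\ell$ is its length, $|\lambda|=\sum_i\lambda_i$ its size, and $m_i(\lambda)$ the multiplicity of $i$ as a part. Partitions are identified with sequences obtained by appending zeros. Lecture hall partitions. For a positive integer $N$, $\mathcal{L}_N$ is the set of partitions $\mu$ with $\ell(\mu)\le N$ and $$\frac{\mu_1}{N}\ge\frac{\mu_2}{N-1}\ge\dots\ge\frac{\mu_{\ell(\mu)}}{N-\ell(\mu)+1}$$ (lecture hall partitions of width $N$; $\emptyset\in\mathcal{L}_N$). A partition $\mu\in\mathcal{L}_N$ is reduced if for every $i$ with $1\le i\le \ell(\mu)$ the sequence obtained from $\mu$ by replacing $\mu_i$ with $\mu_i-(N-i+1)$ (and leaving the other entries unchanged) is not in $\mathcal{L}_N$; here trailing zeros are deleted, and a sequence that is not a partition is not in $\mathcal{L}_N$. $\mathcal{RL}_N$ is the set of reduced elements of $\mathcal{L}_N$. Odd partitions. $\mathcal{OP}_N$ is the set of partitions all of whose parts are odd and at most $2N$ (so parts lie in $\{1,3,\dots,2N-1\}$), and $\mathcal{ROP}_N=\{\lambda\in\mathcal{OP}_N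 : m_{2k-1}(\lambda)\le N-k \text{ for all } 1\le k\le N\}$. -}

module Defs where

open import Data.Fin.Base using (Fin; zero; suc; toℕ)
open import Data.Fin.Properties using (all?)
open import Data.Integer.Base as ℤ using (ℤ; +_; ∣_∣)
import Data.Integer.Properties as ℤ
open import Data.List.Base using (List; []; _∷_; _++_; map; filter; foldr; length)
open import Data.List.Membership.Propositional using (_∈_)
open import Data.List.Membership.Propositional.Properties
  using (∈-map⁺; ∈-map⁻; ∈-++⁺ˡ; ∈-++⁺ʳ; ∈-++⁻; ∈-filter⁺; ∈-filter⁻)
open import Data.List.Properties using (≡-dec; ∷-injectiveʳ; map-id; map-∘)
open import Data.List.Relation.Unary.All as All using (All; []; _∷_)
open import Data.List.Relation.Unary.Any using (here)
open import Data.List.Relation.Unary.AllPairs using ([]; _∷_)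
open import Data.List.Relation.Unary.Linked using (Linked; linked?)
open import Data.List.Relation.Unary.Unique.Propositional using (Unique)
import Data.List.Relation.Unary.Unique.Propositional.Properties as Unique
open import Data.Nat.Base using (ℕ; zero; suc; _*_; _∸_; _≤_; _<_; _≥_; z≤n; s≤s)
open import Data.Nat.Divisibility using (_∤_; _∣?_)
open import Data.Nat.ListAction using (sum)
open import Data.Nat.Properties
  using (_≟_; _≤?_; _<?_; _≥?_; ≤-pred; suc-injective; allUpTo?)
open import Data.Product.Base using (∃-syntax; _×_; _,_; proj₁; proj₂)
open import Data.Rational.Unnormalised.Base as ℚᵘ using (ℚᵘ; _/_)
import Data.Rational.Unnormalised.Properties as ℚᵘ
open import Data.Sum.Base using (inj₁; inj₂)
open import Relation.Binary.PropositionalEquality using (_≡_; refl; sym; trans; cong; subst)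
open import Relation.Nullary.Decidable using (map′; ¬?; _×-dec_; _→-dec_)
open import Relation.Nullary.Negation using (¬_)
open import Relation.Unary using (Pred; Decidable)
open import Level using (0ℓ)

------------------------------------------------------------------------
-- Partitions

IsPartition : Pred (List ℕ) 0ℓ
IsPartition μ = Linked _≥_ μ × All (0 <_) μ

isPartition? : Decidable IsPartition
isPartition? μ = linked? _≥?_ μ ×-dec All.all? (0 <?_) μ

multiplicity : ℕ → List ℕ → ℕ
multiplicity i μ = length (filter (i ≟_) μ)

------------------------------------------------------------------------
-- Lecture hall partitions

-- μ₁/N, μ₂/(N-1), μ₃/(N-2), …  The second clause would cut off a list longer
-- than N; `LectureHall` requires length μ ≤ N, so there it loses no entry.
ratios : ℕ → List ℕ → List ℚᵘ
ratios _       []       = []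
ratios zero    (_ ∷ _)  = []
ratios (suc n) (a ∷ as) = (+ a / suc n) ∷ ratios n as

LectureHall : ℕ → Pred (List ℕ) 0ℓ
LectureHall N μ = IsPartition μ × length μ ≤ N × Linked ℚᵘ._≥_ (ratios N μ)

lectureHall? : ∀ N → Decidable (LectureHall N)
lectureHall? N μ =
  isPartition? μ ×-dec length μ ≤? N ×-dec linked? ℚᵘ._≥?_ (ratios N μ)

-- Subtracting from a part may produce a negative entry or a zero, so the
-- modified sequences live in List ℤ.
subtractAt : (μ : List ℕ) → Fin (length μ) → ℕ → List ℤ
subtractAt (a ∷ as) zero    d = (+ a ℤ.- + d) ∷ map +_ as
subtractAt (a ∷ as) (suc i) d = + a ∷ subtractAt as i d

deleteTrailingZeros : List ℤ → List ℤ
deleteTrailingZeros = foldr cons []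
  where
  cons : ℤ → List ℤ → List ℤ
  cons (+ zero) [] = []
  cons x        xs = x ∷ xs

LectureHallℤ : ℕ → Pred (List ℤ) 0ℓ
LectureHallℤ N s = ∃[ ν ] LectureHall N ν × map +_ ν ≡ deleteTrailingZeros s

-- `i` is 0-based, so N ∸ toℕ i is N - i + 1 for the 1-based index; the
-- truncation is harmless since toℕ i < length μ ≤ N.
ReducedLectureHall : ℕ → Pred (List ℕ) 0ℓ
ReducedLectureHall N μ =
  LectureHall N μ ×
  (∀ (i : Fin (length μ)) → ¬ LectureHallℤ N (subtractAt μ i (N ∸ toℕ i)))

lectureHallℤ? : ∀ N → Decidable (LectureHallℤ N)
lectureHallℤ? N s = map′
  (λ (p , eq) → map ∣_∣ t , p , eq)
  (λ (ν , p , eq) →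
    let ν≡ = trans (sym (map-id ν)) (trans (map-∘ ν) (cong (map ∣_∣) eq))
    in subst (LectureHall N) ν≡ p , trans (cong (map +_) (sym ν≡)) eq)
  (lectureHall? N (map ∣_∣ t) ×-dec ≡-dec ℤ._≟_ (map +_ (map ∣_∣ t)) t)
  where
  t = deleteTrailingZeros s

reducedLectureHall? : ∀ N → Decidable (ReducedLectureHall N)
reducedLectureHall? N μ =
  lectureHall? N μ ×-dec
  all? (λ i → ¬? (lectureHallℤ? N (subtractAt μ i (N ∸ toℕ i))))

------------------------------------------------------------------------
-- Odd partitions

OddPartition : ℕ → Pred (List ℕ) 0ℓ
OddPartition N μ = IsPartition μ × All (λ p → 2 ∤ p × p ≤ 2 * N) μ

ReducedOddPartition : ℕ → Pred (List ℕ) 0ℓ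
ReducedOddPartition N μ =
  OddPartition N μ ×
  (∀ k → 1 ≤ k → k ≤ N → multiplicity (2 * k ∸ 1) μ ≤ N ∸ k)

oddPartition? : ∀ N → Decidable (OddPartition N)
oddPartition? N μ =
  isPartition? μ ×-dec All.all? (λ p → ¬? (2 ∣? p) ×-dec p ≤? 2 * N) μ

reducedOddPartition? : ∀ N → Decidable (ReducedOddPartition N)
reducedOddPartition? N μ = oddPartition? N μ ×-dec map′
  (λ f k 1≤k k≤N → f {k} (s≤s k≤N) 1≤k)
  (λ f {k} k<1+N 1≤k → f k 1≤k (≤-pred k<1+N))
  (allUpTo? (λ k → 1 ≤? k →-dec multiplicity (2 * k ∸ 1) μ ≤? N ∸ k) (suc N))

------------------------------------------------------------------------
-- Generating functions

incrementHead : List ℕ → List ℕ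
incrementHead []       = []
incrementHead (a ∷ as) = suc a ∷ as

compositions : ℕ → List (List ℕ)
compositions 0             = [] ∷ []
compositions 1             = (1 ∷ []) ∷ []
compositions (suc (suc n)) =
  map incrementHead (compositions (suc n)) ++ map (1 ∷_) (compositions (suc n))

-- The list of all partitions of n, without repetition: see
-- `partitions-sound`, `partitions-complete` and `partitions-unique`.
partitions : ℕ → List (List ℕ)
partitions n = filter isPartition? (compositions n)

-- The formal power series Σ q^|μ| over the partitions μ satisfying P,
-- as its sequence of coefficients.
generatingFunction : {P : Pred (List ℕ) 0ℓ} → Decidable P → ℕ → ℕ
generatingFunction P? n = length (filter P? (partitions n))

private
  compositions-sound : ∀ n {μ} → μ ∈ compositions n → All (0 <_) μ × sum μ ≡ n
  compositions-sound 0 (here refl) = [] , refl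
  compositions-sound 1 (here refl) = s≤s z≤n ∷ [] , refl
  compositions-sound (suc (suc n)) μ∈
    with ih ← (λ ν → compositions-sound (suc n) {ν})
    with ∈-++⁻ (map incrementHead (compositions (suc n))) μ∈
  ... | inj₁ μ∈ˡ with ∈-map⁻ incrementHead μ∈ˡ
  ...   | [] , ν∈ , refl with () ← proj₂ (ih _ ν∈)
  ...   | _ ∷ _ , ν∈ , refl with (_ ∷ pos , eq) ← ih _ ν∈ = s≤s z≤n ∷ pos , cong suc eq
  compositions-sound (suc (suc n)) μ∈ | inj₂ μ∈ʳ with ∈-map⁻ (1 ∷_) μ∈ʳ
  ...   | _ , ν∈ , refl with (pos , eq) ← ih _ ν∈ = s≤s z≤n ∷ pos , cong suc eq

  compositions-complete : ∀ n {μ} → All (0 <_) μ → sum μ ≡ n → μ ∈ compositions n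
  compositions-complete 0 {[]} _ _ = here refl
  compositions-complete 0 {zero ∷ _} (() ∷ _) _
  compositions-complete 1 {1 ∷ []} _ _ = here refl
  compositions-complete 1 {zero ∷ _} (() ∷ _) _
  compositions-complete 1 {1 ∷ zero ∷ _} (_ ∷ () ∷ _) _
  compositions-complete (suc (suc n)) {zero ∷ _} (() ∷ _) _
  compositions-complete (suc (suc n)) {1 ∷ _} (_ ∷ pos) eq =
    ∈-++⁺ʳ (map incrementHead (compositions (suc n)))
      (∈-map⁺ (1 ∷_) (compositions-complete (suc n) pos (suc-injective eq)))
  compositions-complete (suc (suc n)) {suc (suc a) ∷ _} (_ ∷ pos) eq =
    ∈-++⁺ˡ (∈-map⁺ incrementHead
      (compositions-complete (suc n) (s≤s z≤n ∷ pos) (suc-injective eq)))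

  incrementHead-injective : ∀ {μ ν} → incrementHead μ ≡ incrementHead ν → μ ≡ ν
  incrementHead-injective {[]}    {[]}    refl = refl
  incrementHead-injective {_ ∷ _} {_ ∷ _} refl = refl

  compositions-unique : ∀ n → Unique (compositions n)
  compositions-unique 0 = [] ∷ []
  compositions-unique 1 = [] ∷ []
  compositions-unique (suc (suc n)) = Unique.++⁺
    (Unique.map⁺ incrementHead-injective (compositions-unique (suc n)))
    (Unique.map⁺ ∷-injectiveʳ (compositions-unique (suc n)))
    disjoint
    where
    disjoint : ∀ {μ} → ¬ (μ ∈ map incrementHead (compositions (suc n)) ×
                          μ ∈ map (1 ∷_) (compositions (suc n)))
    disjoint (∈ˡ , ∈ʳ) with ∈-map⁻ incrementHead ∈ˡ | ∈-map⁻ (1 ∷_) ∈ʳ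
    ... | zero ∷ _ , ν∈ , refl | _ , _ , _ with (() ∷ _) ← proj₁ (compositions-sound (suc n) ν∈)
    ... | [] , _ , refl | _ , _ , ()
    ... | suc _ ∷ _ , _ , refl | _ , _ , ()

partitions-sound : ∀ n {μ} → μ ∈ partitions n → IsPartition μ × sum μ ≡ n
partitions-sound n μ∈ with (μ∈c , p) ← ∈-filter⁻ isPartition? {xs = compositions n} μ∈ =
  p , proj₂ (compositions-sound n μ∈c)

partitions-complete : ∀ n {μ} → IsPartition μ → sum μ ≡ n → μ ∈ partitions n
partitions-complete n p eq =
  ∈-filter⁺ isPartition? (compositions-complete n (proj₂ p) eq) p

partitions-unique : ∀ n → Unique (partitions n)
partitions-unique n = Unique.filter⁺ isPartition? (compositions-unique n)

{-# OPTIONS --safe #-}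

-- Both sets are built recursively from their analogues of width N, by adding one integer
-- 0 ≤ s ≤ N.  A reduced odd partition of width N + 1 is obtained by adding 2 to every part
-- and appending s ones.  A reduced lecture hall partition (x , w) of width N + 1 consists of
-- a reduced one w of width N and an x which is s above its least possible value.  Before
-- prepending x, the second, fourth, … entries of w are each reflected in the interval left
-- to them by their neighbours (as in Bousquet-Mélou and Eriksson's proof of the lecture hall
-- theorem): with o and e the sums of the entries in odd and even position, this gives
-- o′ = 2 o - e + s and e′ = o, while the odd partition satisfies o + e = size and
-- o - e = length, and these two relations are preserved by the recursion.

module Submission where

open import Defs
open import Data.Bool.Base using (true; false)
open import Data.Fin.Base using (zero; suc; toℕ)
open import Data.Integer.Base as ℤ using (-[1+_])
import Data.Integer.Properties as ℤ
open import Data.List.Base using (List; []; _∷_; _++_; map; replicate; length; filter)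
open import Data.List.Membership.Propositional using (_∈_)
open import Data.List.Membership.Propositional.Properties using (∈-map⁺; ∈-map⁻; ∈-filter⁺; ∈-filter⁻)
open import Data.List.Membership.Propositional.Properties.WithK using (unique∧set⇒bag)
open import Data.List.Properties
  using (length-++; length-map; length-replicate; filter-++; filter-none; filter-all;
         ∷-injective; ∷-injectiveˡ; ∷-injectiveʳ; map-injective)
open import Data.List.Relation.Binary.BagAndSetEquality using (∼bag⇒↭)
open import Data.List.Relation.Binary.Permutation.Propositional.Properties using (↭-length)
open import Data.List.Relation.Unary.All as All using (All; []; _∷_)
import Data.List.Relation.Unary.All.Properties as All
open import Data.List.Relation.Unary.AllPairs using ([]; _∷_)
open import Data.List.Relation.Unary.Linked as Linked using (Linked; []; [-]; _∷_)
open import Data.List.Relation.Unary.Unique.Propositional using (Unique)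
import Data.List.Relation.Unary.Unique.Propositional.Properties as Unique
open import Data.Nat.Base
open import Data.Nat.Divisibility using (_∤_; ∣-refl; ∣m∣n⇒∣m+n; ∣m+n∣m⇒∣n; ∣1⇒≡1)
open import Data.Nat.DivMod using (_/_; _%_; m≡m%n+[m/n]*n; m%n<n; m<n*o⇒m/o<n)
open import Data.Nat.ListAction using (sum)
open import Data.Nat.Properties
open import Data.Nat.Tactic.RingSolver using (solve-∀)
open import Data.Product.Base using (∃-syntax; _×_; _,_; proj₁; proj₂)
import Data.Rational.Unnormalised.Base as ℚᵘ
open import Data.Vec.Base using (Vec; []; _∷_)
import Data.Vec.Properties as Vec
open import Function.Base using (_∘_; case_of_)
open import Function.Bundles using (mk⇔)
open import Relation.Binary.PropositionalEquality
open import Relation.Nullary.Negation using (¬_; contradiction)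

-- The extremal values of neighbouring entries

⌈_/suc_⌉ : ℕ → ℕ → ℕ
⌈ x /suc i ⌉ = (x + i) / suc i

x≤[1+i]*⌈x/1+i⌉ : ∀ i x → x ≤ suc i * ⌈ x /suc i ⌉
x≤[1+i]*⌈x/1+i⌉ i x = +-cancelˡ-≤ i _ _ (begin
  i + x                                       ≡⟨ +-comm i x ⟩
  x + i                                       ≡⟨ m≡m%n+[m/n]*n (x + i) (suc i) ⟩
  (x + i) % suc i + ⌈ x /suc i ⌉ * suc i      ≤⟨ +-mono-≤ (≤-pred (m%n<n (x + i) (suc i)))
                                                   (≤-reflexive (*-comm ⌈ x /suc i ⌉ (suc i))) ⟩
  i + suc i * ⌈ x /suc i ⌉                    ∎)
  where open ≤-Reasoning

⌈x/1+i⌉≤ : ∀ i {x y} → x ≤ suc i * y → ⌈ x /suc i ⌉ ≤ y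
⌈x/1+i⌉≤ i {x} {y} x≤ = ≤-pred (m<n*o⇒m/o<n {n = suc y} (begin-strict
  x + i           <⟨ +-mono-≤-< x≤ (n<1+n i) ⟩
  suc i * y + suc i ≡⟨ lemma i y ⟩
  suc y * suc i   ∎))
  where
  open ≤-Reasoning
  lemma : ∀ i y → suc i * y + suc i ≡ suc y * suc i
  lemma = solve-∀

-- For a / (j + 1) ≥ b / j, `lower j b` is the least possible a and `upper j a`
-- the greatest possible b.  For j = 0 only b = 0 is meaningful.
lower : ℕ → ℕ → ℕ
lower zero    b = b
lower (suc i) b = b + ⌈ b /suc i ⌉

upper : ℕ → ℕ → ℕ
upper j a = a ∸ ⌈ a /suc j ⌉

⌈x/1+i⌉≤x : ∀ i x → ⌈ x /suc i ⌉ ≤ x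
⌈x/1+i⌉≤x i x = ⌈x/1+i⌉≤ i (m≤m+n x (i * x))

-- The ceiling added by `lower (suc j)` is the one removed by `upper j`, so the rounding cancels.
-- This makes the sum computation for the reflection exact.
upper+lower : ∀ j a → upper j a + lower (suc j) a ≡ a + a
upper+lower j a = begin
  (a ∸ c) + (a + c)   ≡⟨ cong (a ∸ c +_) (+-comm a c) ⟩
  (a ∸ c) + (c + a)   ≡⟨ +-assoc (a ∸ c) c a ⟨
  (a ∸ c) + c + a     ≡⟨ cong (_+ a) (m∸n+n≡m (⌈x/1+i⌉≤x j a)) ⟩
  a + a               ∎
  where
  open ≡-Reasoning
  c = ⌈ a /suc j ⌉

lower≤⇒ : ∀ i b {a} → lower (suc i) b ≤ a → suc (suc i) * b ≤ suc i * a
lower≤⇒ i b {a} l≤a = begin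
  b + suc i * b                        ≤⟨ +-monoˡ-≤ (suc i * b) (x≤[1+i]*⌈x/1+i⌉ i b) ⟩
  suc i * c + suc i * b                ≡⟨ +-comm (suc i * c) (suc i * b) ⟩
  suc i * b + suc i * c                ≡⟨ *-distribˡ-+ (suc i) b c ⟨
  suc i * (b + c)                      ≤⟨ *-monoʳ-≤ (suc i) l≤a ⟩
  suc i * a                            ∎
  where
  open ≤-Reasoning
  c = ⌈ b /suc i ⌉

-- In terms of `d = a - b` the ratio inequality reads `b ≤ (i + 1) d`, the form in which ceilings
-- are characterised.
difference : ∀ i {a b} → suc (suc i) * b ≤ suc i * a → ∃[ d ] (b + d ≡ a × b ≤ suc i * d)
difference i {a} {b} le = a ∸ b , b+d≡a , +-cancelˡ-≤ (suc i * b) _ _ (begin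
  suc i * b + b              ≡⟨ +-comm (suc i * b) b ⟩
  suc (suc i) * b            ≤⟨ le ⟩
  suc i * a                  ≡⟨ cong (suc i *_) b+d≡a ⟨
  suc i * (b + (a ∸ b))      ≡⟨ *-distribˡ-+ (suc i) b (a ∸ b) ⟩
  suc i * b + suc i * (a ∸ b) ∎)
  where
  open ≤-Reasoning
  b+d≡a : b + (a ∸ b) ≡ a
  b+d≡a = m+[n∸m]≡n (*-cancelˡ-≤ (suc i) (≤-trans (m≤n+m _ b) le))

⇒lower≤ : ∀ i b {a} → suc (suc i) * b ≤ suc i * a → lower (suc i) b ≤ a
⇒lower≤ i b {a} le with d , refl , b≤ ← difference i {a} {b} le = +-monoʳ-≤ b (⌈x/1+i⌉≤ i b≤)

≤upper⇒ : ∀ i a {b} → b ≤ upper (suc i) a → suc (suc i) * b ≤ suc i * a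
≤upper⇒ i a {b} b≤u = +-cancelˡ-≤ a _ _ (begin
  a + suc (suc i) * b                      ≤⟨ +-monoˡ-≤ _ (x≤[1+i]*⌈x/1+i⌉ (suc i) a) ⟩
  suc (suc i) * c + suc (suc i) * b        ≡⟨ +-comm (suc (suc i) * c) _ ⟩
  suc (suc i) * b + suc (suc i) * c        ≡⟨ *-distribˡ-+ (suc (suc i)) b c ⟨
  suc (suc i) * (b + c)                    ≤⟨ *-monoʳ-≤ (suc (suc i)) (m≤o∸n⇒m+n≤o b (⌈x/1+i⌉≤x (suc i) a) b≤u) ⟩
  suc (suc i) * a                          ∎)
  where
  open ≤-Reasoning
  c = ⌈ a /suc suc i ⌉

⇒≤upper : ∀ i a {b} → suc (suc i) * b ≤ suc i * a → b ≤ upper (suc i) a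
⇒≤upper i a {b} le with d , refl , b≤ ← difference i {a} {b} le =
  -- Adding `d` to both sides of `b ≤ (i + 1) d` bounds the ceiling of `(b + d) / (i + 2)` by `d`.
  m+n≤o⇒m≤o∸n b (+-monoʳ-≤ b (⌈x/1+i⌉≤ (suc i) (≤-trans (+-monoˡ-≤ d b≤) (≤-reflexive (+-comm (suc i * d) d)))))

lower-mono-≤ : ∀ j {a b} → a ≤ b → lower j a ≤ lower j b
lower-mono-≤ zero    a≤b = a≤b
lower-mono-≤ (suc i) {a} {b} a≤b = ⇒lower≤ i a (≤-trans (*-monoʳ-≤ (suc (suc i)) a≤b) (lower≤⇒ i b ≤-refl))

lower-0 : ∀ j → lower j 0 ≡ 0
lower-0 zero    = refl
lower-0 (suc i) = n≤0⇒n≡0 (⇒lower≤ i 0 (≤-reflexive (trans (*-zeroʳ (suc (suc i))) (sym (*-zeroʳ (suc i))))))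

≤lower : ∀ j b → b ≤ lower j b
≤lower zero    b = ≤-refl
≤lower (suc i) b = m≤m+n b _

-- Increasing `b` by `i + 1` and `a` by `i + 2` adds `(i + 1)(i + 2)` to both sides of
-- `(i + 2) b ≤ (i + 1) a`, so the least solution `a` moves by `i + 2`.
lower-shift : ∀ i b → lower (suc i) (b + suc i) ≡ lower (suc i) b + suc (suc i)
lower-shift i b = ≤-antisym
  (⇒lower≤ i (b + suc i) (begin
    suc (suc i) * (b + suc i)              ≡⟨ *-distribˡ-+ (suc (suc i)) b (suc i) ⟩
    suc (suc i) * b + suc (suc i) * suc i  ≤⟨ +-mono-≤ (lower≤⇒ i b ≤-refl) (≤-reflexive (*-comm (suc (suc i)) (suc i))) ⟩
    suc i * lower (suc i) b + suc i * suc (suc i) ≡⟨ *-distribˡ-+ (suc i) (lower (suc i) b) _ ⟨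
    suc i * (lower (suc i) b + suc (suc i)) ∎))
  (m≤o∸n⇒m+n≤o (lower (suc i) b) big (⇒lower≤ i b (+-cancelʳ-≤ (suc (suc i) * suc i) _ _ (begin
    suc (suc i) * b + suc (suc i) * suc i ≡⟨ *-distribˡ-+ (suc (suc i)) b (suc i) ⟨
    suc (suc i) * (b + suc i)             ≤⟨ lower≤⇒ i (b + suc i) ≤-refl ⟩
    suc i * L                             ≡⟨ cong (suc i *_) (m∸n+n≡m big) ⟨
    suc i * (L ∸ suc (suc i) + suc (suc i)) ≡⟨ *-distribˡ-+ (suc i) (L ∸ suc (suc i)) _ ⟩
    suc i * (L ∸ suc (suc i)) + suc i * suc (suc i) ≡⟨ cong (suc i * (L ∸ suc (suc i)) +_)
                                                            (*-comm (suc i) (suc (suc i))) ⟩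
    suc i * (L ∸ suc (suc i)) + suc (suc i) * suc i ∎))))
  where
  open ≤-Reasoning
  L = lower (suc i) (b + suc i)
  big : suc (suc i) ≤ L
  big = *-cancelˡ-≤ (suc i) (begin
    suc i * suc (suc i)       ≡⟨ *-comm (suc i) (suc (suc i)) ⟩
    suc (suc i) * suc i       ≤⟨ *-monoʳ-≤ (suc (suc i)) (m≤n+m (suc i) b) ⟩
    suc (suc i) * (b + suc i) ≤⟨ lower≤⇒ i (b + suc i) ≤-refl ⟩
    suc i * L ∎)

-- Both bounds encode the same cross-multiplied inequality, so `lower (suc i)` and `upper (suc i)`
-- form a Galois connection.
lower≤⇒≤upper : ∀ i a b → lower (suc i) b ≤ a → b ≤ upper (suc i) a
lower≤⇒≤upper i a b l≤a = ⇒≤upper i a (lower≤⇒ i b l≤a)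

≤upper⇒lower≤ : ∀ i a b → b ≤ upper (suc i) a → lower (suc i) b ≤ a
≤upper⇒lower≤ i a b b≤u = ⇒lower≤ i b (≤upper⇒ i a b≤u)

-- Contrapositive of the Galois connection at `b + (i + 1)`: by `lower-shift`, `upper (suc i) a`
-- reaches `b + (i + 1)` exactly when `a` reaches `lower (suc i) b + (i + 2)`.
≤lower+⇒upper≤+ : ∀ i a b → a ≤ lower (suc i) b + suc i → upper (suc i) a ≤ b + i
≤lower+⇒upper≤+ i a b a≤ = ≮⇒≥ λ b+i<u → <-irrefl refl (begin-strict
  lower (suc i) b + suc i       <⟨ +-monoʳ-< (lower (suc i) b) (n<1+n (suc i)) ⟩
  lower (suc i) b + suc (suc i) ≡⟨ lower-shift i b ⟨
  lower (suc i) (b + suc i)     ≤⟨ ≤upper⇒lower≤ i a (b + suc i) (≤-trans (≤-reflexive (+-suc b i)) b+i<u) ⟩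
  a                             ≤⟨ a≤ ⟩
  lower (suc i) b + suc i       ∎)
  where open ≤-Reasoning

upper≤+⇒≤lower+ : ∀ i a b → upper (suc i) a ≤ b + i → a ≤ lower (suc i) b + suc i
upper≤+⇒≤lower+ i a b u≤ = ≮⇒≥ λ l+i<a → <-irrefl refl (begin-strict
  b + i                         <⟨ +-monoʳ-< b (n<1+n i) ⟩
  b + suc i                     ≤⟨ lower≤⇒≤upper i a (b + suc i)
                                     (subst (_≤ a) (sym (trans (lower-shift i b) (+-suc (lower (suc i) b) (suc i)))) l+i<a) ⟩
  upper (suc i) a               ≤⟨ u≤ ⟩
  b + i                         ∎)
  where open ≤-Reasoning

-- Chains and the reflection of their entries in even position

head₀ : ∀ {n} → Vec ℕ n → ℕ
head₀ []      = 0
head₀ (a ∷ _) = a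

-- Reduced lecture hall partitions of width n, padded with zeros to length n: subtracting
-- j + 1 from a lowers a / (j + 1) by one, so being reduced means that consecutive ratios
-- satisfy 0 ≤ a / (j + 1) - b / j < 1 and that the last entry is 0.
data Chain : ∀ {n} → Vec ℕ n → Set where
  []   : Chain []
  cons : ∀ {n a} {v : Vec ℕ n} →
         lower n (head₀ v) ≤ a → a ≤ lower n (head₀ v) + n → Chain v → Chain (a ∷ v)

-- Here `a` and `c` are entries in odd position, which stay fixed, so the reflections do not
-- interfere with one another. A last entry `b` is treated as if followed by 0.
reflect : ℕ → ∀ {n} → Vec ℕ n → Vec ℕ n
reflect a []                        = []
reflect a {suc zero}    (b ∷ [])    = (upper 1 a + lower 0 0 ∸ b) ∷ []
reflect a {suc (suc n)} (b ∷ c ∷ v) = (upper (suc (suc n)) a + lower (suc n) c ∸ b) ∷ c ∷ reflect c v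

reflectTail : ∀ {n} → Vec ℕ n → Vec ℕ n
reflectTail []      = []
reflectTail (a ∷ v) = a ∷ reflect a v

-- Given its neighbours a and c, the admissible values of b form the interval with ends
-- lower j c ⊔ (upper (1 + j) a ∸ j) and upper (1 + j) a ⊓ (lower j c + j), which is
-- symmetric under b ↦ upper (1 + j) a + lower j c ∸ b.
mirror : ∀ j a b c →
  lower (suc j) b ≤ a → a ≤ lower (suc j) b + suc j → lower j c ≤ b → b ≤ lower j c + j →
  let b′ = upper (suc j) a + lower j c ∸ b in
  b + b′ ≡ upper (suc j) a + lower j c ×
  lower (suc j) b′ ≤ a × a ≤ lower (suc j) b′ + suc j × lower j c ≤ b′ × b′ ≤ lower j c + j
mirror j a b c l≤a a≤l l≤b b≤l =
  b+b′ ,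
  -- Each bound on `b′` is obtained from the opposite bound on `b` by means of `b + b′ ≡ u + l`.
  ≤upper⇒lower≤ j a b′ (+-cancelˡ-≤ b _ _ (begin
    b + b′ ≡⟨ b+b′ ⟩
    u + l ≤⟨ +-monoʳ-≤ u l≤b ⟩
    u + b ≡⟨ +-comm u b ⟩
    b + u ∎)) ,
  upper≤+⇒≤lower+ j a b′ (+-cancelʳ-≤ l _ _ (begin
    u + l ≡⟨ b+b′ ⟨
    b + b′ ≤⟨ +-monoˡ-≤ b′ b≤l ⟩
    l + j + b′ ≡⟨ lemma l j b′ ⟩
    b′ + j + l ∎)) ,
  m+n≤o⇒m≤o∸n l (begin
    l + b ≤⟨ +-monoʳ-≤ l b≤u ⟩
    l + u ≡⟨ +-comm l u ⟩
    u + l ∎) ,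
  +-cancelˡ-≤ b _ _ (begin
    b + b′ ≡⟨ b+b′ ⟩
    u + l ≤⟨ +-monoˡ-≤ l (≤lower+⇒upper≤+ j a b a≤l) ⟩
    b + j + l ≡⟨ +-assoc b j l ⟩
    b + (j + l) ≡⟨ cong (b +_) (+-comm j l) ⟩
    b + (l + j) ∎)
  where
  open ≤-Reasoning
  u = upper (suc j) a
  l = lower j c
  b′ = u + l ∸ b
  b≤u : b ≤ u
  b≤u = lower≤⇒≤upper j a b l≤a
  b+b′ : b + b′ ≡ u + l
  b+b′ = m+[n∸m]≡n (≤-trans b≤u (m≤m+n u l))
  lemma : ∀ x y z → x + y + z ≡ z + y + x
  lemma = solve-∀

mirror-involutive : ∀ j a b c → lower (suc j) b ≤ a →
  upper (suc j) a + lower j c ∸ (upper (suc j) a + lower j c ∸ b) ≡ b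
mirror-involutive j a b c p =
  m∸[m∸n]≡n (≤-trans (lower≤⇒≤upper j a b p) (m≤m+n (upper (suc j) a) (lower j c)))

reflectTail-chain : ∀ {n} {v : Vec ℕ n} → Chain v → Chain (reflectTail v)
reflectTail-chain [] = []
reflectTail-chain (cons p q []) = cons p q []
reflectTail-chain {v = a ∷ b ∷ []} (cons p q (cons r s [])) =
  let (_ , p′ , q′ , r′ , s′) = mirror 0 a b 0 p q r s in cons p′ q′ (cons r′ s′ [])
reflectTail-chain {v = a ∷ b ∷ c ∷ _} (cons p q (cons r s ch)) =
  let (_ , p′ , q′ , r′ , s′) = mirror _ a b c p q r s in cons p′ q′ (cons r′ s′ (reflectTail-chain ch))

reflectTail-involutive : ∀ {n} {v : Vec ℕ n} → Chain v → reflectTail (reflectTail v) ≡ v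
reflectTail-involutive [] = refl
reflectTail-involutive (cons p q []) = refl
reflectTail-involutive {v = a ∷ b ∷ []} (cons p q (cons r s [])) =
  cong (λ x → a ∷ x ∷ []) (mirror-involutive 0 a b 0 p)
reflectTail-involutive {v = a ∷ b ∷ c ∷ _} (cons p q (cons r s ch)) =
  cong₂ (λ x y → a ∷ x ∷ y) (mirror-involutive _ a b c p) (reflectTail-involutive ch)

oddSum evenSum : ∀ {n} → Vec ℕ n → ℕ
oddSum []       = 0
oddSum (a ∷ v)  = a + evenSum v
evenSum []      = 0
evenSum (_ ∷ v) = oddSum v

oddSum-reflectTail : ∀ {n} (v : Vec ℕ n) → oddSum (reflectTail v) ≡ oddSum v
oddSum-reflectTail []              = refl
oddSum-reflectTail (_ ∷ [])        = refl
oddSum-reflectTail (_ ∷ _ ∷ [])    = refl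
oddSum-reflectTail (a ∷ _ ∷ c ∷ v) = cong (a +_) (oddSum-reflectTail (c ∷ v))

-- Each reflected entry contributes `b + b′`, an `upper` term of its left neighbour plus a `lower`
-- term of its right one. The `lower` term in front completes the pair for the first entry, and
-- `upper+lower` turns every pair into twice the entry in odd position.
evenSum-reflectTail : ∀ {n} {v : Vec ℕ n} → Chain v →
  lower n (head₀ v) + evenSum (reflectTail v) + evenSum v ≡ oddSum v + oddSum v
evenSum-reflectTail [] = refl
-- A last entry in odd position gets no `upper` term from a right neighbour, but the bounds of
-- `Chain` make it 0.
evenSum-reflectTail {v = zero ∷ []} (cons p q []) = refl
evenSum-reflectTail {v = suc _ ∷ []} (cons p () [])
evenSum-reflectTail {v = a ∷ b ∷ []} (cons p q (cons r s [])) =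
  let (e , _) = mirror 0 a b 0 p q r s in
  trans (trans (lemma (lower 2 a) (upper 1 a + lower 0 0 ∸ b) b) (trans (cong (_+ lower 2 a) e) (rearrange (upper 1 a) (lower 2 a))))
    (trans (upper+lower 1 a) (cong₂ _+_ (sym (+-identityʳ a)) (sym (+-identityʳ a))))
  where
  lemma : ∀ x y z → x + (y + 0) + (z + 0) ≡ z + y + x
  lemma = solve-∀
  rearrange : ∀ x y → x + 0 + y ≡ x + y
  rearrange = solve-∀
evenSum-reflectTail {v = _∷_ {n = suc (suc n)} a (b ∷ c ∷ v)} (cons p q (cons r s ch)) = begin
  la + (b′ + e′) + (b + e)  ≡⟨ rearrange₁ la b′ e′ b e ⟩
  b + b′ + (la + e′ + e)    ≡⟨ cong (_+ (la + e′ + e)) (proj₁ (mirror (suc n) a b c p q r s)) ⟩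
  ua + lc + (la + e′ + e)   ≡⟨ rearrange₂ ua lc la e′ e ⟩
  ua + la + (lc + e′ + e)   ≡⟨ cong₂ _+_ (upper+lower (suc (suc n)) a) (evenSum-reflectTail ch) ⟩
  a + a + (o + o)           ≡⟨ rearrange₃ a o ⟩
  a + o + (a + o)           ∎
  where
  open ≡-Reasoning
  la = lower (suc (suc (suc n))) a
  lc = lower (suc n) c
  ua = upper (suc (suc n)) a
  b′ = ua + lc ∸ b
  e′ = evenSum (reflectTail (c ∷ v))
  e  = evenSum (c ∷ v)
  o  = oddSum (c ∷ v)
  rearrange₁ : ∀ x y z u v → x + (y + z) + (u + v) ≡ u + y + (x + z + v)
  rearrange₁ = solve-∀
  rearrange₂ : ∀ x y z u v → x + y + (z + u + v) ≡ x + z + (y + u + v)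
  rearrange₂ = solve-∀
  rearrange₃ : ∀ x y → x + x + (y + y) ≡ x + y + (x + y)
  rearrange₃ = solve-∀

-- Odd partitions

extend : List ℕ → ℕ → List ℕ
extend P s = map (2 +_) P ++ replicate s 1

length-extend : ∀ P s → length (extend P s) ≡ length P + s
length-extend P s = trans (length-++ (map (2 +_) P)) (cong₂ _+_ (length-map (2 +_) P) (length-replicate s))

sum-extend : ∀ P s → sum (extend P s) ≡ sum P + (length P + length P) + s
sum-extend []      zero    = refl
sum-extend []      (suc s) = cong suc (sum-extend [] s)
sum-extend (p ∷ P) s       = trans (cong (2 + p +_) (sum-extend P s)) (rearrange p (sum P) (length P) s)
  where
  rearrange : ∀ p x l s → 2 + p + (x + (l + l) + s) ≡ p + x + (suc l + suc l) + s
  rearrange = solve-∀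

extend-injective : ∀ P Q {s t} → extend P s ≡ extend Q t → P ≡ Q × s ≡ t
extend-injective []      []      {s} {t} eq =
  refl , trans (sym (length-replicate s)) (trans (cong length eq) (length-replicate t))
extend-injective []      (_ ∷ _) {zero}  ()
extend-injective []      (_ ∷ _) {suc _} ()
extend-injective (_ ∷ _) []      {t = zero}  ()
extend-injective (_ ∷ _) []      {t = suc _} ()
extend-injective (p ∷ P) (q ∷ Q) eq with refl , eq′ ← ∷-injective eq with refl , refl ← extend-injective P Q eq′ =
  refl , refl

linked-extend⁺ : ∀ {P} s → Linked _≥_ P → Linked _≥_ (extend P s)
linked-extend⁺ zero          []       = []
linked-extend⁺ (suc zero)    []       = [-]
linked-extend⁺ (suc (suc s)) []       = ≤-refl ∷ linked-extend⁺ (suc s) []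
linked-extend⁺ zero          [-]      = [-]
linked-extend⁺ (suc s)       [-]      = s≤s z≤n ∷ linked-extend⁺ (suc s) []
linked-extend⁺ s             (p≥q ∷ l) = s≤s (s≤s p≥q) ∷ linked-extend⁺ s l

linked-extend⁻ : ∀ P {s} → Linked _≥_ (extend P s) → Linked _≥_ P
linked-extend⁻ []          _         = []
linked-extend⁻ (_ ∷ [])    _         = [-]
linked-extend⁻ (_ ∷ q ∷ P) (s≤s (s≤s p≥q) ∷ l) = p≥q ∷ linked-extend⁻ (q ∷ P) l

multiplicity-1-extend : ∀ P s → multiplicity 1 (extend P s) ≡ s
multiplicity-1-extend P s = begin
  length (filter (1 ≟_) (map (2 +_) P ++ replicate s 1))                   ≡⟨ cong length (filter-++ (1 ≟_) (map (2 +_) P) _) ⟩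
  length (filter (1 ≟_) (map (2 +_) P) ++ filter (1 ≟_) (replicate s 1))   ≡⟨ cong₂ (λ xs ys → length (xs ++ ys))
                                                                                (filter-none (1 ≟_) (All.map⁺ (All.universal (λ _ ()) P)))
                                                                                (filter-all (1 ≟_) (All.replicate⁺ s refl)) ⟩
  length (replicate s 1)                                                   ≡⟨ length-replicate s ⟩
  s                                                                        ∎
  where open ≡-Reasoning

multiplicity-2+-extend : ∀ i P s → multiplicity (2 + i) (extend P s) ≡ multiplicity i P
multiplicity-2+-extend i []      s = cong length (filter-none (2 + i ≟_) (All.replicate⁺ s λ ()))
-- The comparison of `2 + i` with `2 + p` computes to that of `i` with `p`, so this boolean decides
-- both filters.
multiplicity-2+-extend i (p ∷ P) s with i ≡ᵇ p
... | true  = cong suc (multiplicity-2+-extend i P s)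
... | false = multiplicity-2+-extend i P s

multiplicity-odd-extend : ∀ k P s →
  multiplicity (2 * suc (suc k) ∸ 1) (extend P s) ≡ multiplicity (2 * suc k ∸ 1) P
multiplicity-odd-extend k P s =
  trans (cong (λ x → multiplicity x (extend P s)) (cong suc (+-suc k _)))
        (multiplicity-2+-extend (2 * suc k ∸ 1) P s)

2*[1+n] : ∀ n → 2 * suc n ≡ 2 + 2 * n
2*[1+n] n = *-suc 2 n

-- Adding 2 sends the part `2 k - 1` to `2 k + 1`, and `(n + 1) - (k + 1)` is `n - k`, so the old
-- multiplicity bounds carry over. The new bound, for the part 1, is `s ≤ n`.
reducedOdd-extend⁺ : ∀ {n P s} → s ≤ n → ReducedOddPartition n P → ReducedOddPartition (suc n) (extend P s)
reducedOdd-extend⁺ {n} {P} {s} s≤n (((linked , _) , odd) , mult) =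
  ((linked-extend⁺ s linked ,
    All.++⁺ (All.map⁺ (All.universal (λ _ → z<s) P)) (All.replicate⁺ s z<s)) ,
   All.++⁺ (All.map⁺ (All.map (λ (2∤p , p≤) → (λ d → 2∤p (∣m+n∣m⇒∣n d ∣-refl)) , ≤-trans (s≤s (s≤s p≤)) (≤-reflexive (sym (2*[1+n] n)))) odd))
           (All.replicate⁺ s ((λ d → case ∣1⇒≡1 d of λ ()) , s≤s z≤n))) ,
  mult′
  where
  mult′ : ∀ k → 1 ≤ k → k ≤ suc n → multiplicity (2 * k ∸ 1) (extend P s) ≤ suc n ∸ k
  mult′ (suc zero) _ _ = ≤-trans (≤-reflexive (multiplicity-1-extend P s)) s≤n
  mult′ (suc (suc k)) _ (s≤s k<n) = ≤-trans (≤-reflexive (multiplicity-odd-extend k P s)) (mult (suc k) (s≤s z≤n) k<n)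

-- By weak decrease the ones come last. `P` may contain zeros here, from parts equal to 2; oddness
-- excludes them in `reducedOdd-extend⁻`.
partition-extend : ∀ {Q} → IsPartition Q → ∃[ P ] ∃[ s ] Q ≡ extend P s
partition-extend {[]} _ = [] , 0 , refl
partition-extend {suc (suc q) ∷ Q} (linked , _ ∷ pos) with P , s , eq ← partition-extend (Linked.tail linked , pos) =
  q ∷ P , s , cong (suc (suc q) ∷_) eq
partition-extend {1 ∷ Q} (linked , _ ∷ pos) with partition-extend (Linked.tail linked , pos)
... | []    , s , refl = [] , suc s , refl
... | _ ∷ _ , _ , refl with s≤s () ← Linked.head linked

reducedOdd-extend⁻ : ∀ {n} P s → ReducedOddPartition (suc n) (extend P s) → s ≤ n × ReducedOddPartition n P
reducedOdd-extend⁻ {n} P s (((linked , _) , odd) , mult) =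
  subst (_≤ n) (multiplicity-1-extend P s) (mult 1 (s≤s z≤n) (s≤s z≤n)) ,
  ((linked-extend⁻ P linked , All.map (λ {p} → positive {p}) odd′) ,
   All.map (λ {p} (2∤2+p , p≤) → (λ d → 2∤2+p (∣m∣n⇒∣m+n ∣-refl d)) , ≤-pred (≤-pred (subst (2 + p ≤_) (2*[1+n] n) p≤))) odd′) ,
  mult′
  where
  odd′ : All (λ p → 2 ∤ 2 + p × 2 + p ≤ 2 * suc n) P
  odd′ = All.map⁻ (All.++⁻ˡ (map (2 +_) P) odd)
  positive : ∀ {p} → 2 ∤ 2 + p × 2 + p ≤ 2 * suc n → 0 < p
  positive {zero}  (2∤2 , _) = contradiction ∣-refl 2∤2
  positive {suc _} _         = z<s
  mult′ : ∀ k → 1 ≤ k → k ≤ n → multiplicity (2 * k ∸ 1) P ≤ n ∸ k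
  mult′ (suc k) _ k<n = ≤-trans (≤-reflexive (sym (multiplicity-odd-extend k P s))) (mult (suc (suc k)) (s≤s z≤n) (s≤s k<n))

-- From chains to reduced odd partitions

-- The entry x in front of v is lower n (head₀ v) + s with 0 ≤ s ≤ n, and s becomes the
-- multiplicity of 1.
toOdd : ∀ n → Vec ℕ n → List ℕ
toOdd zero    []      = []
toOdd (suc n) (x ∷ v) = extend (toOdd n (reflectTail v)) (x ∸ lower n (head₀ v))

toOdd-reduced : ∀ n {v} → Chain v → ReducedOddPartition n (toOdd n v)
toOdd-reduced zero    [] = ((([] , []) , []) , λ { zero () _ ; (suc k) _ () })
toOdd-reduced (suc n) (cons _ q ch) =
  reducedOdd-extend⁺ (m≤n+o⇒m∸n≤o _ _ q) (toOdd-reduced n (reflectTail-chain ch))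

toOdd-injective : ∀ n {v w} → Chain v → Chain w → toOdd n v ≡ toOdd n w → v ≡ w
toOdd-injective zero [] [] _ = refl
toOdd-injective (suc n) {x ∷ v} {y ∷ w} (cons p _ chv) (cons q _ chw) eq
  with eq₁ , eq₂ ← extend-injective (toOdd n (reflectTail v)) _ eq
  with refl ← trans (sym (reflectTail-involutive chv))
                (trans (cong reflectTail (toOdd-injective n (reflectTail-chain chv) (reflectTail-chain chw) eq₁))
                  (reflectTail-involutive chw))
  = cong (_∷ v) (∸-cancelʳ-≡ p q eq₂)

toOdd-surjective : ∀ n {P} → ReducedOddPartition n P → ∃[ v ] (Chain v × toOdd n v ≡ P)
toOdd-surjective zero {[]} _ = [] , [] , refl
toOdd-surjective zero {zero ∷ P} (((_ , () ∷ _) , _) , _)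
toOdd-surjective zero {suc p ∷ P} ((_ , (_ , ()) ∷ _) , _)
toOdd-surjective (suc n) rop@((part , _) , _)
  with P , s , refl ← partition-extend part
  with s≤n , rop′ ← reducedOdd-extend⁻ P s rop
  with v , ch , refl ← toOdd-surjective n rop′ =
  -- `toOdd` reflects the tail before recursing, so the tail of the preimage is `reflectTail v`,
  -- which is reflected back to `v`.
  lower n (head₀ (reflectTail v)) + s ∷ reflectTail v ,
  cons (m≤m+n _ s) (+-monoʳ-≤ (lower n (head₀ (reflectTail v))) s≤n) (reflectTail-chain ch) ,
  cong₂ extend (cong (toOdd n) (reflectTail-involutive ch)) (m+n∸m≡n (lower n (head₀ (reflectTail v))) s)

-- The second relation needs the first, as `extend` adds twice the length to the size. Prepending
-- `x` makes `o` the new even sum, and the induction hypothesis concerns the reflected tail.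
oddSum-toOdd : ∀ n {v} → Chain v →
  oddSum v ≡ evenSum v + length (toOdd n v) × oddSum v + evenSum v ≡ sum (toOdd n v)
oddSum-toOdd zero [] = refl , refl
oddSum-toOdd (suc n) {x ∷ v} (cons {a = x} {v = v} p _ ch)
  with ih₁ , ih₂ ← oddSum-toOdd n (reflectTail-chain ch) =
  (begin
    x + e                   ≡⟨ x+e≡o+l+s ⟩
    o + (l + s)             ≡⟨ cong (o +_) (length-extend P s) ⟨
    o + length (extend P s) ∎) ,
  (begin
    x + e + o               ≡⟨ cong (_+ o) x+e≡o+l+s ⟩
    o + (l + s) + o         ≡⟨ cong (o + (l + s) +_) o≡e′+l ⟩
    o + (l + s) + (e′ + l)  ≡⟨ rearrange₁ o l s e′ ⟩
    o + e′ + (l + l) + s    ≡⟨ cong (λ y → y + (l + l) + s) (trans (cong (_+ e′) (sym (oddSum-reflectTail v))) ih₂) ⟩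
    sum P + (l + l) + s     ≡⟨ sum-extend P s ⟨
    sum (extend P s)        ∎)
  where
  open ≡-Reasoning
  P  = toOdd n (reflectTail v)
  L  = lower n (head₀ v)
  s  = x ∸ L
  o  = oddSum v
  e  = evenSum v
  e′ = evenSum (reflectTail v)
  l  = length P
  rearrange₁ : ∀ o l s e → o + (l + s) + (e + l) ≡ o + e + (l + l) + s
  rearrange₁ = solve-∀
  rearrange₂ : ∀ L e e′ → L + e + e′ ≡ L + e′ + e
  rearrange₂ = solve-∀
  rearrange₃ : ∀ o l e → o + (e + l) ≡ o + l + e
  rearrange₃ = solve-∀
  rearrange₄ : ∀ L s e → L + s + e ≡ L + e + s
  rearrange₄ = solve-∀
  o≡e′+l : o ≡ e′ + l
  o≡e′+l = trans (sym (oddSum-reflectTail v)) ih₁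
  -- By the reflection identity `L + e` is `2 o - e′`, and `o - e′` is the length `l`.
  L+e≡o+l : L + e ≡ o + l
  L+e≡o+l = +-cancelʳ-≡ e′ _ _ (begin
    L + e + e′   ≡⟨ rearrange₂ L e e′ ⟩
    L + e′ + e   ≡⟨ evenSum-reflectTail ch ⟩
    o + o        ≡⟨ cong (o +_) o≡e′+l ⟩
    o + (e′ + l) ≡⟨ rearrange₃ o l e′ ⟩
    o + l + e′   ∎)
  x+e≡o+l+s : x + e ≡ o + (l + s)
  x+e≡o+l+s = begin
    x + e       ≡⟨ cong (_+ e) (m+[n∸m]≡n p) ⟨
    L + s + e   ≡⟨ rearrange₄ L s e ⟩
    L + e + s   ≡⟨ cong (_+ s) L+e≡o+l ⟩
    o + l + s   ≡⟨ +-assoc o l s ⟩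
    o + (l + s) ∎

-- Lecture hall partitions

first : List ℕ → ℕ
first []      = 0
first (a ∷ _) = a

-- Integer form of `LectureHall`: the index bounds the length, and weak decrease follows from
-- `≤lower`.
data Hall : ℕ → List ℕ → Set where
  []   : ∀ {n} → Hall n []
  cons : ∀ {n a μ} → 0 < a → lower n (first μ) ≤ a → Hall n μ → Hall (suc n) (a ∷ μ)

lectureHall⇒hall : ∀ {n μ} → LectureHall n μ → Hall n μ
lectureHall⇒hall {μ = []} _ = []
lectureHall⇒hall {zero} {_ ∷ _} (_ , () , _)
lectureHall⇒hall {suc n} {a ∷ []} ((_ , 0<a ∷ _) , _) = cons 0<a (≤-trans (≤-reflexive (lower-0 n)) z≤n) []
lectureHall⇒hall {suc zero} {_ ∷ _ ∷ _} (_ , s≤s () , _)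
lectureHall⇒hall {suc (suc n)} {a ∷ b ∷ μ} ((_ ∷ linked , 0<a ∷ pos) , s≤s len , ℚᵘ.*≤* r ∷ ratios≥) =
  cons 0<a
    (⇒lower≤ n b (subst₂ _≤_ (*-comm b _) (*-comm a _) (ℤ.drop‿+≤+ (subst₂ ℤ._≤_ (sym (ℤ.pos-* b _)) (sym (ℤ.pos-* a _)) r))))
    (lectureHall⇒hall ((linked , pos) , len , ratios≥))

hall⇒lectureHall : ∀ {n μ} → Hall n μ → LectureHall n μ
hall⇒lectureHall [] = ([] , []) , z≤n , []
hall⇒lectureHall (cons 0<a _ []) = ([-] , 0<a ∷ []) , s≤s z≤n , [-]
hall⇒lectureHall {suc (suc n)} {a ∷ b ∷ μ} (cons 0<a l≤a hall@(cons _ _ _))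
  with (linked , pos) , len , ratios≥ ← hall⇒lectureHall hall =
  (≤-trans (≤lower (suc n) b) l≤a ∷ linked , 0<a ∷ pos) , s≤s len ,
  ℚᵘ.*≤* (subst₂ ℤ._≤_ (ℤ.pos-* b _) (ℤ.pos-* a _) (ℤ.+≤+ (subst₂ _≤_ (*-comm _ b) (*-comm _ a) (lower≤⇒ n b l≤a)))) ∷ ratios≥

-- Subtraction from a single entry

hall-positive : ∀ {n μ} → Hall n μ → All (0 <_) μ
hall-positive [] = []
hall-positive (cons 0<a _ h) = 0<a ∷ hall-positive h

first≡0⇒[] : ∀ {n μ} → Hall n μ → first μ ≡ 0 → μ ≡ []
first≡0⇒[] [] _ = refl
first≡0⇒[] (cons 0<a _ _) refl = contradiction 0<a λ ()

deleteTrailingZeros-positive : ∀ {μ} → All (0 <_) μ → deleteTrailingZeros (map ℤ.+_ μ) ≡ map ℤ.+_ μ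
deleteTrailingZeros-positive []                      = refl
deleteTrailingZeros-positive {suc _ ∷ _} (_ ∷ pos)   = cong (_ ∷_) (deleteTrailingZeros-positive pos)

pos-minus⁻ : ∀ {x} a d → ℤ.+ a ℤ.- ℤ.+ d ≡ ℤ.+ x → a ≡ x + d
pos-minus⁻ {x} a d eq = ℤ.+-injective (begin
  ℤ.+ a                       ≡⟨ ℤ.+-identityʳ (ℤ.+ a) ⟨
  ℤ.+ a ℤ.+ ℤ.0ℤ              ≡⟨ cong (λ z → ℤ.+ a ℤ.+ z) (ℤ.+-inverseˡ (ℤ.+ d)) ⟨
  ℤ.+ a ℤ.+ (ℤ.- ℤ.+ d ℤ.+ ℤ.+ d) ≡⟨ ℤ.+-assoc (ℤ.+ a) (ℤ.- ℤ.+ d) (ℤ.+ d) ⟨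
  ℤ.+ a ℤ.- ℤ.+ d ℤ.+ ℤ.+ d       ≡⟨ cong (λ z → z ℤ.+ ℤ.+ d) eq ⟩
  ℤ.+ x ℤ.+ ℤ.+ d               ≡⟨ ℤ.pos-+ x d ⟨
  ℤ.+ (x + d)                 ∎)
  where open ≡-Reasoning

pos-minus⁺ : ∀ {a d} → d ≤ a → ℤ.+ a ℤ.- ℤ.+ d ≡ ℤ.+ (a ∸ d)
pos-minus⁺ {a} {d} d≤a = trans (ℤ.m-n≡m⊖n a d) (ℤ.⊖-≥ d≤a)

first-deleteTrailingZeros : ∀ z s {ν x} → map ℤ.+_ ν ≡ deleteTrailingZeros (z ∷ s) → z ℤ.≤ ℤ.+ x → first ν ≤ x
first-deleteTrailingZeros _ _ {[]} _ _ = z≤n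
first-deleteTrailingZeros (ℤ.+ zero) s {_ ∷ _} eq _ with deleteTrailingZeros s
first-deleteTrailingZeros (ℤ.+ zero) s {zero ∷ _} eq _ | _ ∷ _ = z≤n
first-deleteTrailingZeros (ℤ.+ suc _) _ {_ ∷ _} {x} eq z≤x =
  ℤ.drop‿+≤+ (subst (ℤ._≤ (ℤ.+ x)) (sym (∷-injectiveˡ eq)) z≤x)
first-deleteTrailingZeros -[1+ _ ] _ {_ ∷ _} ()

-- Guarantees in `subtract-later⁺` that the entry before the modified tail still satisfies its lower
-- bound.
first-subtractAt : ∀ μ i d {ν} → map ℤ.+_ ν ≡ deleteTrailingZeros (subtractAt μ i d) → first ν ≤ first μ
first-subtractAt (a ∷ μ) zero    d eq = first-deleteTrailingZeros _ (map ℤ.+_ μ) eq (ℤ.i-j≤i (ℤ.+ a) (ℤ.+ d))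
first-subtractAt (a ∷ μ) (suc i) d eq = first-deleteTrailingZeros _ (subtractAt μ i d) eq ℤ.≤-refl

subtract-first⁺ : ∀ {n a μ} → Hall n μ → lower n (first μ) + suc n ≤ a →
  LectureHallℤ (suc n) (subtractAt (a ∷ μ) zero (suc n))
subtract-first⁺ {n} {a} {μ} h le rewrite pos-minus⁺ (≤-trans (m≤n+m (suc n) _) le)
  with a ∸ suc n | m+n≤o⇒m≤o∸n (lower n (first μ)) le
-- A first entry that drops to 0 forces the rest to be empty, and the whole sequence is deleted.
... | zero  | l≤0 rewrite first≡0⇒[] h (n≤0⇒n≡0 (≤-trans (≤lower n (first μ)) l≤0)) = [] , hall⇒lectureHall [] , refl
... | suc x | l≤x = suc x ∷ μ , hall⇒lectureHall (cons z<s l≤x h) , cong (_ ∷_) (sym (deleteTrailingZeros-positive (hall-positive h)))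

-- A positive tail is untouched by the deletion of zeros, so the head disappears only if it is 0 and
-- the tail is empty; a negative head would survive and cannot lie in `ν`.
prepend⁻ : ∀ {n} z {μ ν} → Hall n μ → Hall (suc n) ν → map ℤ.+_ ν ≡ deleteTrailingZeros (z ∷ map ℤ.+_ μ) →
  ∃[ x ] (z ≡ ℤ.+ x × lower n (first μ) ≤ x)
prepend⁻ {n} (ℤ.+ zero) [] _ _ = 0 , refl , ≤-reflexive (lower-0 n)
prepend⁻ (ℤ.+ zero) {suc _ ∷ _} (cons _ _ _) (cons 0<y _ _) eq =
  contradiction (subst (0 <_) (ℤ.+-injective (∷-injectiveˡ eq)) 0<y) λ ()
prepend⁻ {n} (ℤ.+ suc x) {μ} h (cons {μ = ν} _ l≤y _) eq =
  suc x , refl ,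
  subst₂ (λ κ y → lower n (first κ) ≤ y)
    (map-injective ℤ.+-injective (trans (∷-injectiveʳ eq) (deleteTrailingZeros-positive (hall-positive h))))
    (ℤ.+-injective (∷-injectiveˡ eq)) l≤y
prepend⁻ -[1+ _ ] _ [] ()
prepend⁻ -[1+ _ ] _ (cons _ _ _) ()

subtract-first⁻ : ∀ {n a μ} → Hall n μ → LectureHallℤ (suc n) (subtractAt (a ∷ μ) zero (suc n)) →
  lower n (first μ) + suc n ≤ a
subtract-first⁻ {n} {a} h (ν , lh , eq) with x , z≡ , l≤x ← prepend⁻ (ℤ.+ a ℤ.- ℤ.+ suc n) h (lectureHall⇒hall lh) eq =
  ≤-trans (+-monoˡ-≤ (suc n) l≤x) (≤-reflexive (sym (pos-minus⁻ a (suc n) z≡)))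

-- The positive head survives the deletion of zeros, so only its lower bound has to be checked again
-- for the new tail.
subtract-later⁺ : ∀ {n a} μ i d → Hall (suc n) (a ∷ μ) →
  LectureHallℤ n (subtractAt μ i d) → LectureHallℤ (suc n) (subtractAt (a ∷ μ) (suc i) d)
subtract-later⁺ {n} {suc a} μ i d (cons 0<a l≤a _) (ν , lh , eq) =
  suc a ∷ ν ,
  hall⇒lectureHall (cons 0<a (≤-trans (lower-mono-≤ n (first-subtractAt μ i d eq)) l≤a) (lectureHall⇒hall lh)) ,
  cong (_ ∷_) eq

subtract-later⁻ : ∀ {n a} μ i d → 0 < a →
  LectureHallℤ (suc n) (subtractAt (a ∷ μ) (suc i) d) → LectureHallℤ n (subtractAt μ i d)
subtract-later⁻ {a = suc a} μ i d _ (y ∷ ν , lh , eq) with cons _ _ h ← lectureHall⇒hall lh =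
  ν , hall⇒lectureHall h , ∷-injectiveʳ eq

-- Reduced lecture hall partitions as chains

pad : ∀ n → List ℕ → Vec ℕ n
pad zero    _       = []
pad (suc n) []      = 0 ∷ pad n []
pad (suc n) (a ∷ μ) = a ∷ pad n μ

head₀-pad : ∀ {n μ} → Hall n μ → head₀ (pad n μ) ≡ first μ
head₀-pad {zero}  []           = refl
head₀-pad {suc n} []           = refl
head₀-pad         (cons _ _ _) = refl

pad-[]-chain : ∀ n → Chain (pad n [])
pad-[]-chain zero    = []
pad-[]-chain (suc n) = cons (≤-reflexive (trans (cong (lower n) (head₀-pad {n} [])) (lower-0 n))) z≤n (pad-[]-chain n)

-- The lower bounds come from `Hall`. If the upper bound on `a` failed, `n + 1` could be subtracted
-- from it.
irreducible⇒chain : ∀ {n μ} → Hall n μ → (∀ i → ¬ LectureHallℤ n (subtractAt μ i (n ∸ toℕ i))) → Chain (pad n μ)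
irreducible⇒chain [] _ = pad-[]-chain _
irreducible⇒chain {suc n} {a ∷ μ} hall@(cons 0<a l≤a h) irreducible =
  cons (subst (λ y → lower n y ≤ a) (sym (head₀-pad h)) l≤a)
    (subst (λ y → a ≤ lower n y + n) (sym (head₀-pad h))
      (≮⇒≥ λ l+n<a → irreducible zero (subtract-first⁺ h (≤-trans (≤-reflexive (+-suc _ n)) l+n<a))))
    -- The amounts subtracted agree, since `(n + 1) - (i + 1)` is `n - i`.
    (irreducible⇒chain h λ i red → irreducible (suc i) (subtract-later⁺ μ i _ hall red))

chain⇒irreducible : ∀ {n μ} → Hall n μ → Chain (pad n μ) → ∀ i → ¬ LectureHallℤ n (subtractAt μ i (n ∸ toℕ i))
chain⇒irreducible {suc n} {a ∷ μ} (cons _ _ h) (cons _ a≤l+n _) zero red =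
  <-irrefl refl (≤-trans (≤-reflexive (sym (+-suc _ n))) (≤-trans (subtract-first⁻ h red) (subst (λ y → a ≤ lower n y + n) (head₀-pad h) a≤l+n)))
chain⇒irreducible {μ = _ ∷ μ} (cons 0<a _ h) (cons _ _ ch) (suc i) red = chain⇒irreducible h ch i (subtract-later⁻ μ i _ 0<a red)

-- A zero entry forces the next one to be 0 by `≤lower`, so zeros occur only as padding.
chain⇒hall : ∀ {n} {v : Vec ℕ n} → Chain v → ∃[ μ ] (Hall n μ × pad n μ ≡ v)
chain⇒hall [] = [] , [] , refl
chain⇒hall {suc n} (cons {a = zero} l≤0 _ ch) with μ , h , refl ← chain⇒hall ch
  with refl ← first≡0⇒[] h (n≤0⇒n≡0 (≤-trans (≤-reflexive (sym (head₀-pad h))) (≤-trans (≤lower n _) l≤0))) = [] , [] , refl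
chain⇒hall {suc n} (cons {a = suc a} l≤a _ ch) with μ , h , refl ← chain⇒hall ch =
  suc a ∷ μ , cons z<s (subst (λ y → lower n y ≤ suc a) (head₀-pad h) l≤a) h , refl

pad-injective : ∀ {n μ ν} → Hall n μ → Hall n ν → pad n μ ≡ pad n ν → μ ≡ ν
pad-injective []             []             _  = refl
pad-injective []             (cons 0<b _ _) eq = contradiction (subst (0 <_) (sym (Vec.∷-injectiveˡ eq)) 0<b) λ ()
pad-injective (cons 0<a _ _) []             eq = contradiction (subst (0 <_) (Vec.∷-injectiveˡ eq) 0<a) λ ()
pad-injective (cons _ _ h)   (cons _ _ k)   eq = cong₂ _∷_ (Vec.∷-injectiveˡ eq) (pad-injective h k (Vec.∷-injectiveʳ eq))

sum-pad : ∀ {n μ} → Hall n μ → oddSum (pad n μ) + evenSum (pad n μ) ≡ sum μ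
sum-pad {zero}  []           = refl
sum-pad {suc n} []           = trans (+-comm (evenSum (pad n [])) _) (sum-pad {n} [])
sum-pad {suc n} {a ∷ μ} (cons _ _ h) =
  trans (+-assoc a _ _) (cong (a +_) (trans (+-comm (evenSum (pad n μ)) _) (sum-pad h)))

-- Comparison of the coefficients

-- Injectivity of `lectureToOdd` is available only on reduced partitions, hence the predicate `P`.
unique-map⁺ : ∀ {A B : Set} {P : A → Set} {f : A → B} → (∀ {x y} → P x → P y → f x ≡ f y → x ≡ y) →
  ∀ {xs} → All P xs → Unique xs → Unique (map f xs)
unique-map⁺ inj []         []             = []
unique-map⁺ inj (px ∷ pxs) (x∉xs ∷ xs!) =
  All.map⁺ (All.zipWith (λ (x≢y , py) → x≢y ∘ inj px py) (x∉xs , pxs)) ∷ unique-map⁺ inj pxs xs!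

-- Lists without repetition that have the same members are permutations of each other.
unique⇒length≡ : ∀ {A : Set} {xs ys : List A} → Unique xs → Unique ys →
  (∀ {x} → x ∈ xs → x ∈ ys) → (∀ {x} → x ∈ ys → x ∈ xs) → length xs ≡ length ys
unique⇒length≡ xs! ys! ⊆ ⊇ = ↭-length (∼bag⇒↭ (unique∧set⇒bag xs! ys! (mk⇔ ⊆ ⊇)))

reduced⇒hall : ∀ {N μ} → ReducedLectureHall N μ → Hall N μ
reduced⇒hall (lh , _) = lectureHall⇒hall lh

reduced⇒chain : ∀ {N μ} → ReducedLectureHall N μ → Chain (pad N μ)
reduced⇒chain red@(_ , irreducible) = irreducible⇒chain (reduced⇒hall red) irreducible

lectureToOdd : ℕ → List ℕ → List ℕ
lectureToOdd N μ = toOdd N (pad N μ)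

lectureToOdd-sum : ∀ {N μ} → ReducedLectureHall N μ → sum (lectureToOdd N μ) ≡ sum μ
lectureToOdd-sum {N} red = trans (sym (proj₂ (oddSum-toOdd N (reduced⇒chain red)))) (sum-pad (reduced⇒hall red))

lectureToOdd-injective : ∀ {N μ ν} → ReducedLectureHall N μ → ReducedLectureHall N ν →
  lectureToOdd N μ ≡ lectureToOdd N ν → μ ≡ ν
lectureToOdd-injective {N} redμ redν eq = pad-injective (reduced⇒hall redμ) (reduced⇒hall redν)
  (toOdd-injective N (reduced⇒chain redμ) (reduced⇒chain redν) eq)

lectureToOdd-surjective : ∀ {N P} → ReducedOddPartition N P → ∃[ μ ] (ReducedLectureHall N μ × lectureToOdd N μ ≡ P)
lectureToOdd-surjective {N} rop with v , ch , refl ← toOdd-surjective N rop with μ , h , refl ← chain⇒hall ch =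
  μ , (hall⇒lectureHall h , chain⇒irreducible h ch) , refl

theorem3p3 : ∀ (N : ℕ) .{{_ : NonZero N}} →
    generatingFunction (reducedLectureHall? N) ≗ generatingFunction (reducedOddPartition? N)
theorem3p3 N n = begin
  length lectures                        ≡⟨ length-map (lectureToOdd N) lectures ⟨
  -- The map preserves size, so both lists consist of the reduced odd partitions of `n`, each
  -- occurring once.
  length (map (lectureToOdd N) lectures) ≡⟨ unique⇒length≡ images! odds! to from ⟩
  length odds                            ∎
  where
  open ≡-Reasoning
  lectures = filter (reducedLectureHall? N) (partitions n)
  odds     = filter (reducedOddPartition? N) (partitions n)
  images! : Unique (map (lectureToOdd N) lectures)
  images! = unique-map⁺ lectureToOdd-injective (All.all-filter (reducedLectureHall? N) (partitions n))
    (Unique.filter⁺ (reducedLectureHall? N) (partitions-unique n))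
  odds! : Unique odds
  odds! = Unique.filter⁺ (reducedOddPartition? N) (partitions-unique n)
  to : ∀ {P} → P ∈ map (lectureToOdd N) lectures → P ∈ odds
  to P∈ with μ , μ∈ , refl ← ∈-map⁻ (lectureToOdd N) P∈
    with μ∈ₙ , red ← ∈-filter⁻ (reducedLectureHall? N) {xs = partitions n} μ∈ =
    let rop = toOdd-reduced N (reduced⇒chain red) in
    ∈-filter⁺ (reducedOddPartition? N)
      (partitions-complete n (proj₁ (proj₁ rop)) (trans (lectureToOdd-sum red) (proj₂ (partitions-sound n μ∈ₙ)))) rop
  from : ∀ {P} → P ∈ odds → P ∈ map (lectureToOdd N) lectures
  from P∈ with P∈ₙ , rop ← ∈-filter⁻ (reducedOddPartition? N) {xs = partitions n} P∈
    with μ , red , refl ← lectureToOdd-surjective rop =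
    ∈-map⁺ (lectureToOdd N) (∈-filter⁺ (reducedLectureHall? N)
      (partitions-complete n (proj₁ (proj₁ red)) (trans (sym (lectureToOdd-sum red)) (proj₂ (partitions-sound n P∈ₙ)))) red)
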